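{- Let $m,n,k$ be positive integers. Let $X_1,X_2,\ldots,X_k$ be pairwise disjoint subsets of $[m]$ and let $Y_1,Y_2,\ldots,Y_k$ be subsets of $[n]$. Label all functions $f:[m]\to[n]$ arbitrarily as $f_1,f_2,\ldots,f_{n^m}$, and form the $k\times n^m$ matrix $B=(b_{ij})$ with $b_{ij}=1$ if $f_j(X_i)=Y_i$ and $b_{ij}=0$ otherwise. Then the number $N$ of columns of $B$ all of whose entries are $0$ is $$N=\sum_{I\subseteq [k]}(-1)^{|I|}B(I),\qquad\text{where}\qquad B(I)=n^{|[m]\setminus \bigcup_{i\in I}X_i|}\cdot \prod_{i\in I}|Y_i|!\,S(|X_i|,|Y_i|),$$ and the sum runs over all subsets $I$ of $[k]$.
   Context: $[n]=\{1,\ldots,n\}$; $|X|$ is the cardinality of $X$; $S(a,b)$ denotes the Stirling number of the second kind. -}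

module Defs where

open import Data.Bool using (if_then_else_) renaming (_≟_ to _≟ᵇ_)
open import Data.Fin using (Fin)
open import Data.Fin.Properties using (any?; all?) renaming (_≟_ to _≟ᶠ_)
open import Data.Fin.Subset using (Subset; inside; outside; _∩_; ∁; ⋃; ∣_∣; Empty)
open import Data.Fin.Subset.Properties using (_∈?_)
open import Data.Integer as ℤ using (ℤ; 0ℤ)
open import Data.List using (List; []; _∷_; _++_; map; foldr; filter; allFin)
open import Data.Nat using (ℕ; zero; suc; _+_; _*_; _^_; _!; _≟_)
open import Data.Nat.ListAction using (product)
open import Data.Vec as Vec using (tabulate)
open import Data.Vec.Properties using (≡-dec)
open import Function.Bundles using (Bijection)
open import Relation.Binary.PropositionalEquality using (_≢_; setoid; _→-setoid_)
open import Relation.Nullary using (does; _×-dec_)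

-- Stirling numbers of the second kind: in a partition of an (a+1)-set into
-- b+1 blocks, a chosen element is either added to one of the b+1 blocks of a
-- partition of the remaining a elements, or forms a block by itself.
S : ℕ → ℕ → ℕ
S zero    zero    = 1
S zero    (suc b) = 0
S (suc a) zero    = 0
S (suc a) (suc b) = suc b * S a (suc b) + S a b

PairwiseDisjoint : ∀ {m k} → (Fin k → Subset m) → Set
PairwiseDisjoint X = ∀ i j → i ≢ j → Empty (X i ∩ X j)

-- Functions [m] → [n] are identified when they agree pointwise, so that a
-- labelling lists each function exactly once in the usual (extensional) sense.
Labelling : ℕ → ℕ → Set
Labelling m n = Bijection (setoid (Fin (n ^ m))) (Fin m →-setoid Fin n)

image : ∀ {m n} → (Fin m → Fin n) → Subset m → Subset n
image f X = tabulate λ y → does (any? λ x → (x ∈? X) ×-dec (f x ≟ᶠ y))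

incidence : ∀ {m n k l} → (Fin k → Subset m) → (Fin k → Subset n) →
            (Fin l → Fin m → Fin n) → Fin k → Fin l → ℕ
incidence X Y f i j =
  if does (≡-dec _≟ᵇ_ (image (f j) (X i)) (Y i)) then 1 else 0

zeroColumns : ∀ {k l} → (Fin k → Fin l → ℕ) → ℕ
zeroColumns b = ∣ tabulate (λ j → does (all? λ i → b i j ≟ 0)) ∣

elements : ∀ {k} → Subset k → List (Fin k)
elements I = filter (_∈? I) (allFin _)

allSubsets : ∀ k → List (Subset k)
allSubsets zero    = Vec.[] ∷ []
allSubsets (suc k) =
  map (outside Vec.∷_) (allSubsets k) ++ map (inside Vec.∷_) (allSubsets k)

∑⊆ : ∀ k → (Subset k → ℤ) → ℤ
∑⊆ k g = foldr ℤ._+_ 0ℤ (map g (allSubsets k))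

∏∈ : ∀ {k} → Subset k → (Fin k → ℕ) → ℕ
∏∈ I g = product (map g (elements I))

⋃∈ : ∀ {m k} → Subset k → (Fin k → Subset m) → Subset m
⋃∈ I X = ⋃ (map X (elements I))

B : ∀ {m n k} → (Fin k → Subset m) → (Fin k → Subset n) → Subset k → ℕ
B {n = n} X Y I =
  n ^ ∣ ∁ (⋃∈ I X) ∣ * ∏∈ I (λ i → ∣ Y i ∣ ! * S ∣ X i ∣ ∣ Y i ∣)

{-# OPTIONS --safe #-}

-- Expanding the product ∏ (1 − b i j) over i pointwise and exchanging sums
-- reduces the claim to counting the functions f with f (X i) = Y i for all
-- i ∈ I.  This count is computed by induction on m.  By disjointness the first
-- element of [m] lies in at most one X i.  If it lies in none, its value is
-- free.  If it lies in X i, its value y must lie in Y i, and the remaining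
-- elements of X i have image either Y i or Y i ∖ {y}; with surj a b = b! S(a,b)
-- this matches the recurrence surj (a+1) b = b (surj a b + surj a (b−1)).
module Submission where

open import Defs
import Algebra.Properties.Semiring.Sum as Sum
open import Data.Bool using (Bool; true; false; _∧_; _∨_; if_then_else_) renaming (_≟_ to _≟ᵇ_)
open import Data.Fin using (Fin; zero; suc; _↑ˡ_; _↑ʳ_; combine; finToFun; funToFin)
open import Data.Fin.Permutation using (Permutation′)
open import Data.Fin.Properties using (any?; all?; remQuot-combine; finToFun-funToFin; funToFin-finToFin) renaming (_≟_ to _≟ᶠ_)
open import Data.Fin.Subset using (Subset; inside; outside; _∩_; _∪_; ∁; ⋃; ∣_∣; Empty)
open import Data.Fin.Subset.Properties using (_∈?_; drop-∷-Empty)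
open import Data.Integer as ℤ using (ℤ; +_; -1ℤ; _*_; _^_)
import Data.Integer.Properties as ℤₚ
open import Data.List as List using (List; []; _∷_; _++_; map; foldr; filter; allFin)
import Data.List.Properties as List
open import Data.List.Relation.Unary.All as All using ([]; _∷_)
import Data.List.Relation.Unary.All.Properties as All
open import Data.List.Relation.Unary.AllPairs as AllPairs using (AllPairs; []; _∷_)
import Data.List.Relation.Unary.AllPairs.Properties as AllPairs
open import Data.List.Relation.Unary.Unique.Propositional.Properties using (allFin⁺; filter⁺)
open import Data.Nat as ℕ using (ℕ; zero; suc; pred; NonZero; _!)
open import Data.Nat.ListAction using (product)
open import Data.Nat.ListAction.Properties using (product-++)
import Data.Nat.Properties as ℕₚ
open import Data.Nat.Tactic.RingSolver using (solve-∀)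
open import Data.Product using (_×_; _,_; proj₁; proj₂)
open import Data.Vec as Vec using ([]; _∷_; tabulate; lookup; _[_]≔_; here)
open import Data.Vec.Functional using () renaming (_∷_ to _∷ᶠ_)
import Data.Vec.Properties as Vec
open import Function using (_∘_; id)
open import Function.Bundles using (Bijection; mk↔ₛ′)
open import Relation.Binary.PropositionalEquality using (_≡_; _≗_; refl; sym; trans; cong; cong₂; module ≡-Reasoning)
open import Relation.Nullary using (does; _×-dec_; contradiction)
open import Relation.Unary using (Decidable)

open import Algebra.Properties.CommutativeSemigroup ℤₚ.*-commutativeSemigroup using (interchange)
open Sum ℕₚ.+-*-semiring using (sum; sum-cong-≗; ∑-distrib-+; *-distribˡ-sum; *-distribʳ-sum; ∑-permute; sum-syntax)
module ℤ∑ = Sum ℤₚ.+-*-semiring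

open ≡-Reasoning

private
  variable
    k l m n : ℕ

-- Images

⟦_⟧ : Bool → ℕ
⟦ p ⟧ = if p then 1 else 0

-- The indicator of `Z ≡ Y`, built from the same decision procedure as `incidence`, so that every
-- matrix entry is a value of `δ` by definition.
δ : Subset n → Subset n → ℕ
δ Z Y = ⟦ does (Vec.≡-dec _≟ᵇ_ Z Y) ⟧

χ : Subset n → Fin n → ℕ
χ Y y = ⟦ lookup Y y ⟧

-- Over `Fin (suc m)` the answer of `any?` computes to the disjunction of the answers at the head
-- and on the tail, so comparing Booleans suffices.
does-any?-cong : {P Q : Fin m → Set} (P? : Decidable P) (Q? : Decidable Q) →
                 (∀ x → does (P? x) ≡ does (Q? x)) → does (any? P?) ≡ does (any? Q?)
does-any?-cong {m = zero}  P? Q? P≗Q = refl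
does-any?-cong {m = suc m} P? Q? P≗Q =
  cong₂ _∨_ (P≗Q zero) (does-any?-cong (P? ∘ suc) (Q? ∘ suc) (P≗Q ∘ suc))

image-cong : {f g : Fin m → Fin n} → f ≗ g → ∀ X → image f X ≡ image g X
image-cong f≗g X = Vec.tabulate-cong λ y → does-any?-cong _ _ λ x →
  cong (λ z → does ((x ∈? X) ×-dec (z ≟ᶠ y))) (f≗g x)

image-outside : (g : Fin (suc m) → Fin n) (X : Subset m) →
                image g (outside ∷ X) ≡ image (g ∘ suc) X
image-outside g X = Vec.tabulate-cong λ y → does-any?-cong
  (λ x → (suc x ∈? (outside ∷ X)) ×-dec (g (suc x) ≟ᶠ y))
  (λ x → (x ∈? X) ×-dec (g (suc x) ≟ᶠ y))
  (λ x → refl)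

tabulate-insert : (y : Fin n) (h : Fin n → Bool) →
                  tabulate (λ z → does (y ≟ᶠ z) ∨ h z) ≡ tabulate h [ y ]≔ inside
tabulate-insert zero    h = refl
tabulate-insert (suc y) h = cong (h zero ∷_) (tabulate-insert y (h ∘ suc))

image-inside : (g : Fin (suc m) → Fin n) (X : Subset m) →
               image g (inside ∷ X) ≡ image (g ∘ suc) X [ g zero ]≔ inside
image-inside g X = trans
  (Vec.tabulate-cong λ y → cong (does (g zero ≟ᶠ y) ∨_) (does-any?-cong
    (λ x → (suc x ∈? (inside ∷ X)) ×-dec (g (suc x) ≟ᶠ y))
    (λ x → (x ∈? X) ×-dec (g (suc x) ≟ᶠ y))
    (λ x → refl)))
  (tabulate-insert (g zero) _)

-- Adding `y` to `Z` gives `Y` exactly when `y` lies in `Y` and `Z` is `Y` or `Y` without `y`. For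
-- `y` in `Y` these alternatives exclude each other, so their indicators add.
δ-insert : (Z Y : Subset n) (y : Fin n) →
           δ (Z [ y ]≔ inside) Y ≡ χ Y y ℕ.* (δ Z Y ℕ.+ δ Z (Y [ y ]≔ outside))
δ-insert (false ∷ Z) (false ∷ Y) zero = refl
δ-insert (false ∷ Z) (true  ∷ Y) zero = sym (ℕₚ.*-identityˡ _)
δ-insert (true  ∷ Z) (false ∷ Y) zero = refl
δ-insert (true  ∷ Z) (true  ∷ Y) zero = sym (trans (ℕₚ.*-identityˡ _) (ℕₚ.+-identityʳ _))
δ-insert (false ∷ Z) (false ∷ Y) (suc y) = δ-insert Z Y y
δ-insert (false ∷ Z) (true  ∷ Y) (suc y) = sym (ℕₚ.*-zeroʳ (χ Y y))
δ-insert (true  ∷ Z) (false ∷ Y) (suc y) = sym (ℕₚ.*-zeroʳ (χ Y y))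
δ-insert (true  ∷ Z) (true  ∷ Y) (suc y) = δ-insert Z Y y

sum-χ : (Y : Subset n) → sum (χ Y) ≡ ∣ Y ∣
sum-χ []          = refl
sum-χ (false ∷ Y) = sum-χ Y
sum-χ (true  ∷ Y) = cong suc (sum-χ Y)

∣tabulate∣ : (p : Fin n → Bool) → ∣ tabulate p ∣ ≡ ∑[ j < n ] ⟦ p j ⟧
∣tabulate∣ p = trans (sym (sum-χ (tabulate p)))
  (sum-cong-≗ λ j → cong ⟦_⟧ (Vec.lookup∘tabulate p j))

∣remove∣ : (Y : Subset n) (y : Fin n) → lookup Y y ≡ inside → suc ∣ Y [ y ]≔ outside ∣ ≡ ∣ Y ∣
∣remove∣ (true  ∷ Y) zero    _   = refl
∣remove∣ (false ∷ Y) (suc y) y∈Y = ∣remove∣ Y y y∈Y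
∣remove∣ (true  ∷ Y) (suc y) y∈Y = cong suc (∣remove∣ Y y y∈Y)

-- Removes the dependence on `y` from the size: for `y` in `Y` the size drops by one, and otherwise
-- the factor `χ Y y` annihilates both sides.
χ-∣remove∣ : (h : ℕ → ℕ) (Y : Subset n) (y : Fin n) →
             χ Y y ℕ.* h ∣ Y [ y ]≔ outside ∣ ≡ χ Y y ℕ.* h (pred ∣ Y ∣)
χ-∣remove∣ h Y y with lookup Y y in y∈Y
... | false = refl
... | true  = cong (λ c → 1 ℕ.* h (pred c)) (∣remove∣ Y y y∈Y)

-- Sums over functions

sum-const : ∀ n c → ∑[ y < n ] c ≡ n ℕ.* c
sum-const zero    c = refl
sum-const (suc n) c = cong (c ℕ.+_) (sum-const n c)

sum-+ : ∀ m (h : Fin (m ℕ.+ n) → ℕ) →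
        sum h ≡ ∑[ i < m ] h (i ↑ˡ n) ℕ.+ ∑[ j < n ] h (m ↑ʳ j)
sum-+ zero    h = refl
sum-+ (suc m) h = trans (cong (h zero ℕ.+_) (sum-+ m (h ∘ suc))) (sym (ℕₚ.+-assoc (h zero) _ _))

sum-combine : ∀ m (h : Fin (m ℕ.* n) → ℕ) →
              sum h ≡ ∑[ i < m ] ∑[ j < n ] h (combine i j)
sum-combine         zero    h = refl
sum-combine {n = n} (suc m) h = trans (sum-+ n h)
  (cong (∑[ j < n ] h (j ↑ˡ _) ℕ.+_) (sum-combine m (h ∘ (n ↑ʳ_))))

-- Needed because decoding a composite index agrees with `y ∷ᶠ g` only pointwise, not as an equality
-- of functions.
Extensional : ((Fin m → Fin n) → ℕ) → Set
Extensional h = ∀ {f g} → f ≗ g → h f ≡ h g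

-- The functions are enumerated canonically, by the base-`n` digits of `j`. This order supports
-- induction on `m`; arbitrary labellings are related to it by `sum-labelling`.
∑→ : ((Fin m → Fin n) → ℕ) → ℕ
∑→ {m} {n} h = ∑[ j < n ℕ.^ m ] h (finToFun j)

∑→-cong : {h h′ : (Fin m → Fin n) → ℕ} → (∀ g → h g ≡ h′ g) → ∑→ h ≡ ∑→ h′
∑→-cong h≗h′ = sum-cong-≗ (h≗h′ ∘ finToFun)

finToFun-combine : (y : Fin n) (j : Fin (n ℕ.^ m)) →
                   finToFun {n} {suc m} (combine y j) ≗ y ∷ᶠ finToFun j
finToFun-combine y j zero    = cong proj₁ (remQuot-combine y j)
finToFun-combine {n} y j (suc x) =
  cong (λ qr → finToFun (proj₂ qr) x) (remQuot-combine {n} y j)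

∑→-suc : (h : (Fin (suc m) → Fin n) → ℕ) → Extensional h →
         ∑→ h ≡ ∑[ y < n ] ∑→ (λ g → h (y ∷ᶠ g))
∑→-suc {m} {n} h ext = trans (sum-combine n _)
  (sum-cong-≗ λ y → sum-cong-≗ λ j → ext (finToFun-combine y j))

funToFin-cong : {f g : Fin m → Fin n} → f ≗ g → funToFin f ≡ funToFin g
funToFin-cong {m = zero}  f≗g = refl
funToFin-cong {m = suc m} f≗g = cong₂ combine (f≗g zero) (funToFin-cong (f≗g ∘ suc))

-- A labelling differs from the canonical enumeration by a permutation of the indices, under which a
-- finite sum is invariant.
sum-labelling : (f : Labelling m n) (h : (Fin m → Fin n) → ℕ) → Extensional h →
                ∑[ j < n ℕ.^ m ] h (Bijection.to f j) ≡ ∑→ h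
sum-labelling {m} {n} f h ext = sym (trans (∑-permute (h ∘ finToFun) π)
  (sum-cong-≗ λ j → ext (finToFun-funToFin (to j))))
  where
  open Bijection f using (to; to⁻; injective; strictlySurjective)
  -- `π` sends a label to the canonical index of the function that it labels.
  π : Permutation′ (n ℕ.^ m)
  π = mk↔ₛ′ (funToFin ∘ to) (to⁻ ∘ finToFun)
    (λ i → trans (funToFin-cong (proj₂ (strictlySurjective (finToFun i))))
                 (funToFin-finToFin {m} i))
    (λ j → injective λ x → trans (proj₂ (strictlySurjective (finToFun (funToFin (to j)))) x)
                                 (finToFun-funToFin (to j) x))

-- Functions with prescribed images of disjoint sets

-- The number of surjections from an `a`-set onto a `b`-set.
surj : ℕ → ℕ → ℕ
surj a b = b ! ℕ.* S a b

surj-suc : ∀ a b →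
  b ℕ.* (surj a b ℕ.+ surj a (pred b)) ≡ surj (suc a) b
-- Here `pred 0` is `0`, which is harmless since the factor `b` vanishes.
surj-suc a zero    = refl
surj-suc a (suc b) = lemma (suc b) (b !) (S a (suc b)) (S a b)
  where
  lemma : ∀ c d s t → c ℕ.* (c ℕ.* d ℕ.* s ℕ.+ d ℕ.* t) ≡ c ℕ.* d ℕ.* (c ℕ.* s ℕ.+ t)
  lemma = solve-∀

-- A pair `(X , Y)` demands that the image of `X` be `Y`. Lists of such pairs let the induction on
-- `m` single out one constraint and change its `Y` alone.
Constraint : ℕ → ℕ → Set
Constraint m n = Subset m × Subset n

satisfied : (Fin m → Fin n) → List (Constraint m n) → ℕ
satisfied g = product ∘ map λ (X , Y) → δ (image g X) Y

weight : List (Constraint m n) → ℕ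
weight = product ∘ map λ (X , Y) → surj ∣ X ∣ ∣ Y ∣

uncovered : List (Constraint m n) → ℕ
uncovered L = ∣ ∁ (⋃ (map proj₁ L)) ∣

Disjoint : List (Constraint m n) → Set
Disjoint = AllPairs λ c d → Empty (proj₁ c ∩ proj₁ d)

product-map-++ : {A : Set} (h : A → ℕ) (xs ys : List A) →
  product (map h (xs ++ ys)) ≡ product (map h xs) ℕ.* product (map h ys)
product-map-++ h xs ys = trans (cong product (List.map-++ h xs ys)) (product-++ (map h xs) _)

satisfied-ext : (L : List (Constraint m n)) → Extensional (λ g → satisfied g L)
satisfied-ext L f≗g = cong product
  (List.map-cong (λ (X , Y) → cong (λ Z → δ Z Y) (image-cong f≗g X)) L)

skip : Constraint m n → Constraint (suc m) n
skip (X , Y) = outside ∷ X , Y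

satisfied-skip : ∀ y (g : Fin m → Fin n) L → satisfied (y ∷ᶠ g) (map skip L) ≡ satisfied g L
satisfied-skip y g L = cong product (trans (sym (List.map-∘ L))
  (List.map-cong (λ (X , Y) → cong (λ Z → δ Z Y) (image-outside (y ∷ᶠ g) X)) L))

weight-skip : (L : List (Constraint m n)) → weight (map skip L) ≡ weight L
weight-skip L = cong product (sym (List.map-∘ L))

⋃-skip : (L : List (Constraint m n)) → ⋃ (map proj₁ (map skip L)) ≡ outside ∷ ⋃ (map proj₁ L)
⋃-skip []            = refl
⋃-skip ((X , Y) ∷ L) = cong ((outside ∷ X) ∪_) (⋃-skip L)

-- The union depends only on the first components, so `Y` and `Y′` may be unrelated. The new first
-- element is covered, hence the number of uncovered elements stays the same.
⋃-hit : ∀ (L₁ L₂ : List (Constraint m n)) X Y Y′ →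
  ⋃ (map proj₁ (map skip L₁ ++ (inside ∷ X , Y) ∷ map skip L₂)) ≡
  inside ∷ ⋃ (map proj₁ (L₁ ++ (X , Y′) ∷ L₂))
⋃-hit []             L₂ X Y Y′ = cong ((inside ∷ X) ∪_) (⋃-skip L₂)
⋃-hit ((X₁ , _) ∷ L₁) L₂ X Y Y′ = cong ((outside ∷ X₁) ∪_) (⋃-hit L₁ L₂ X Y Y′)

-- The first element lies in no first component or in exactly one. In the second case disjointness
-- is kept for every `Y′`, because the recursion runs both with `Y` and with `Y` minus a point.
data Split {m n} : List (Constraint (suc m) n) → Set where
  none : ∀ L → Disjoint L → Split (map skip L)
  one  : ∀ L₁ X Y L₂ → (∀ Y′ → Disjoint (L₁ ++ (X , Y′) ∷ L₂)) →
         Split (map skip L₁ ++ (inside ∷ X , Y) ∷ map skip L₂)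

split : (L : List (Constraint (suc m) n)) → Disjoint L → Split L
split [] [] = none [] []
split ((s ∷ X , Y) ∷ L) (c∩L ∷ disj) with s | split L disj
... | outside | none L′ disj′ =
  none ((X , Y) ∷ L′) (All.map drop-∷-Empty (All.map⁻ c∩L) ∷ disj′)
... | inside  | none L′ disj′ =
  one [] X Y L′ (λ _ → All.map drop-∷-Empty (All.map⁻ c∩L) ∷ disj′)
... | outside | one L₁ X′ Y′ L₂ disj′ with All.++⁻ (map skip L₁) c∩L
...   | c∩L₁ , c∩X′ ∷ c∩L₂ = one ((X , Y) ∷ L₁) X′ Y′ L₂ λ Y″ →
  All.++⁺ (All.map drop-∷-Empty (All.map⁻ c∩L₁))
          (drop-∷-Empty c∩X′ ∷ All.map drop-∷-Empty (All.map⁻ c∩L₂))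
  ∷ disj′ Y″
-- Two sets containing `zero` would violate disjointness.
split ((s ∷ X , Y) ∷ L) (c∩L ∷ disj) | inside | one L₁ X′ Y′ L₂ disj′
  with All.++⁻ (map skip L₁) c∩L
...   | _ , c∩X′ ∷ _ = contradiction (zero , here) c∩X′

-- The base case: a function on the empty set has empty image, and `surj 0 b` is `1` for `b = 0` and
-- `0` otherwise.
δ-∅ : (Y : Subset n) → δ (tabulate λ _ → outside) Y ≡ surj 0 ∣ Y ∣
δ-∅ []          = refl
δ-∅ (false ∷ Y) = δ-∅ Y
δ-∅ (true  ∷ Y) = sym (ℕₚ.*-zeroʳ (suc ∣ Y ∣ !))

-- Only the constraint containing the first element sees the value `y`. Its image gains `y`, and
-- `δ-insert` splits it into two constraints on `g`.
satisfied-hit : ∀ y (g : Fin m → Fin n) L₁ X Y L₂ →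
  satisfied (y ∷ᶠ g) (map skip L₁ ++ (inside ∷ X , Y) ∷ map skip L₂) ≡
  χ Y y ℕ.* (satisfied g (L₁ ++ (X , Y) ∷ L₂) ℕ.+
             satisfied g (L₁ ++ (X , Y [ y ]≔ outside) ∷ L₂))
satisfied-hit y g L₁ X Y L₂ = begin
  satisfied (y ∷ᶠ g) (map skip L₁ ++ (inside ∷ X , Y) ∷ map skip L₂)
    ≡⟨ product-map-++ _ (map skip L₁) _ ⟩
  satisfied (y ∷ᶠ g) (map skip L₁) ℕ.*
    (δ (image (y ∷ᶠ g) (inside ∷ X)) Y ℕ.* satisfied (y ∷ᶠ g) (map skip L₂))
    ≡⟨ cong₂ ℕ._*_ (satisfied-skip y g L₁) (cong₂ ℕ._*_
         (trans (cong (λ Z → δ Z Y) (image-inside (y ∷ᶠ g) X)) (δ-insert (image g X) Y y))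
         (satisfied-skip y g L₂)) ⟩
  p ℕ.* (χ Y y ℕ.* (d Y ℕ.+ d (Y [ y ]≔ outside)) ℕ.* q)
    ≡⟨ rearrange p (χ Y y) (d Y) _ q ⟩
  χ Y y ℕ.* (p ℕ.* (d Y ℕ.* q) ℕ.+ p ℕ.* (d (Y [ y ]≔ outside) ℕ.* q))
    ≡⟨ cong (χ Y y ℕ.*_) (cong₂ ℕ._+_ (product-map-++ _ L₁ _) (product-map-++ _ L₁ _)) ⟨
  _ ∎
  where
  p = satisfied g L₁
  q = satisfied g L₂
  d = δ (image g X)
  rearrange : ∀ p x d d′ q →
    p ℕ.* (x ℕ.* (d ℕ.+ d′) ℕ.* q) ≡ x ℕ.* (p ℕ.* (d ℕ.* q) ℕ.+ p ℕ.* (d′ ℕ.* q))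
  rearrange = solve-∀

∑→-satisfied : (L : List (Constraint m n)) → Disjoint L →
               ∑→ (λ g → satisfied g L) ≡ n ℕ.^ uncovered L ℕ.* weight L
∑→-satisfied {zero} {n} L _ = begin
  satisfied (λ ()) L ℕ.+ 0   ≡⟨ ℕₚ.+-identityʳ _ ⟩
  satisfied (λ ()) L         ≡⟨ cong product (List.map-cong (λ { ([] , Y) → δ-∅ Y }) L) ⟩
  weight L                   ≡⟨ ℕₚ.*-identityˡ _ ⟨
  1 ℕ.* weight L             ≡⟨ cong (λ e → n ℕ.^ e ℕ.* weight L) (∣p∣≡0 (∁ (⋃ (map proj₁ L)))) ⟨
  n ℕ.^ uncovered L ℕ.* weight L ∎
  where
  ∣p∣≡0 : (p : Subset 0) → ∣ p ∣ ≡ 0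
  ∣p∣≡0 [] = refl
∑→-satisfied {suc m} {n} L disj with split L disj
... | none L′ disj′ = begin
  ∑→ (λ g → satisfied g (map skip L′))
    ≡⟨ ∑→-suc (λ g → satisfied g (map skip L′)) (satisfied-ext (map skip L′)) ⟩
  ∑[ y < n ] ∑→ (λ g → satisfied (y ∷ᶠ g) (map skip L′))
    ≡⟨ (sum-cong-≗ λ y → trans (∑→-cong λ g → satisfied-skip y g L′) (∑→-satisfied L′ disj′)) ⟩
  ∑[ y < n ] (n ℕ.^ uncovered L′ ℕ.* weight L′)
    ≡⟨ sum-const n _ ⟩
  n ℕ.* (n ℕ.^ uncovered L′ ℕ.* weight L′)
    -- The first element is uncovered, and its free value supplies the extra factor `n`.
    ≡⟨ ℕₚ.*-assoc n _ _ ⟨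
  n ℕ.^ suc (uncovered L′) ℕ.* weight L′
    ≡⟨ cong₂ (λ U w → n ℕ.^ ∣ ∁ U ∣ ℕ.* w) (⋃-skip L′) (weight-skip L′) ⟨
  n ℕ.^ uncovered (map skip L′) ℕ.* weight (map skip L′) ∎
... | one L₁ X Y L₂ disj′ = begin
  ∑→ (λ g → satisfied g L₀)
    ≡⟨ ∑→-suc (λ g → satisfied g L₀) (satisfied-ext L₀) ⟩
  ∑[ y < n ] ∑→ (λ g → satisfied (y ∷ᶠ g) L₀)
    -- After `step` the value `y` enters only through `χ Y y`, so the sum collapses to `∣ Y ∣` times
    -- a constant.
    ≡⟨ sum-cong-≗ step ⟩
  ∑[ y < n ] (χ Y y ℕ.* total)
    ≡⟨ *-distribʳ-sum total (χ Y) ⟨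
  sum (χ Y) ℕ.* total
    ≡⟨ cong (ℕ._* total) (sum-χ Y) ⟩
  b ℕ.* total
    ≡⟨ factor b K p (surj a b) (surj a (pred b)) q ⟩
  K ℕ.* (p ℕ.* (b ℕ.* (surj a b ℕ.+ surj a (pred b)) ℕ.* q))
    ≡⟨ cong (λ s → K ℕ.* (p ℕ.* (s ℕ.* q))) (surj-suc a b) ⟩
  K ℕ.* (p ℕ.* (surj (suc a) b ℕ.* q))
    ≡⟨ cong₂ ℕ._*_ (cong (λ U → n ℕ.^ ∣ ∁ U ∣) (⋃-hit L₁ L₂ X Y Y))
        (trans (product-map-++ _ (map skip L₁) _)
          (cong₂ ℕ._*_ (weight-skip L₁) (cong (surj (suc a) b ℕ.*_) (weight-skip L₂)))) ⟨
  n ℕ.^ uncovered L₀ ℕ.* weight L₀ ∎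
  where
  L₀ = map skip L₁ ++ (inside ∷ X , Y) ∷ map skip L₂
  a = ∣ X ∣
  b = ∣ Y ∣
  p = weight L₁
  q = weight L₂
  K = n ℕ.^ uncovered (L₁ ++ (X , Y) ∷ L₂)
  value : ℕ → ℕ
  value c = K ℕ.* (p ℕ.* (surj a c ℕ.* q))
  total = value b ℕ.+ value (pred b)
  factor : ∀ b K p s t q →
    b ℕ.* (K ℕ.* (p ℕ.* (s ℕ.* q)) ℕ.+ K ℕ.* (p ℕ.* (t ℕ.* q))) ≡
    K ℕ.* (p ℕ.* (b ℕ.* (s ℕ.+ t) ℕ.* q))
  factor = solve-∀
  count : ∀ Y′ → ∑→ (λ g → satisfied g (L₁ ++ (X , Y′) ∷ L₂)) ≡ value ∣ Y′ ∣
  count Y′ = begin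
    ∑→ (λ g → satisfied g (L₁ ++ (X , Y′) ∷ L₂))
      ≡⟨ ∑→-satisfied (L₁ ++ (X , Y′) ∷ L₂) (disj′ Y′) ⟩
    n ℕ.^ uncovered (L₁ ++ (X , Y′) ∷ L₂) ℕ.* weight (L₁ ++ (X , Y′) ∷ L₂)
      ≡⟨ cong₂ (λ U w → n ℕ.^ ∣ ∁ U ∣ ℕ.* w)
           -- Both unions are the tail of one and the same union, so the power `K` fits every `Y′`.
           (Vec.∷-injectiveʳ (trans (sym (⋃-hit L₁ L₂ X Y Y′)) (⋃-hit L₁ L₂ X Y Y)))
           (product-map-++ _ L₁ _) ⟩
    value ∣ Y′ ∣ ∎
  step : ∀ y → ∑→ (λ g → satisfied (y ∷ᶠ g) L₀) ≡ χ Y y ℕ.* total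
  step y = begin
    ∑→ (λ g → satisfied (y ∷ᶠ g) L₀)
      ≡⟨ ∑→-cong (λ g → satisfied-hit y g L₁ X Y L₂) ⟩
    ∑→ (λ g → χ Y y ℕ.* (satisfied g M ℕ.+ satisfied g M′))
      ≡⟨ *-distribˡ-sum (χ Y y) (λ j → satisfied (finToFun j) M ℕ.+ satisfied (finToFun j) M′) ⟨
    χ Y y ℕ.* ∑→ (λ g → satisfied g M ℕ.+ satisfied g M′)
      ≡⟨ cong (χ Y y ℕ.*_) (∑-distrib-+ {n ℕ.^ m} _ _) ⟩
    χ Y y ℕ.* (∑→ (λ g → satisfied g M) ℕ.+ ∑→ (λ g → satisfied g M′))
      ≡⟨ cong (χ Y y ℕ.*_) (cong₂ ℕ._+_ (count Y) (count _)) ⟩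
    χ Y y ℕ.* (value b ℕ.+ value ∣ Y [ y ]≔ outside ∣)
      ≡⟨ χ-∣remove∣ (λ c → value b ℕ.+ value c) Y y ⟩
    χ Y y ℕ.* total ∎
    where
    M  = L₁ ++ (X , Y) ∷ L₂
    M′ = L₁ ++ (X , Y [ y ]≔ outside) ∷ L₂

-- Sums over subsets

∑⊆-cong : {g h : Subset k → ℤ} → (∀ I → g I ≡ h I) → ∑⊆ k g ≡ ∑⊆ k h
∑⊆-cong {k} g≗h = cong (foldr ℤ._+_ ℤ.0ℤ) (List.map-cong g≗h (allSubsets k))

foldr-+-++ : ∀ xs ys → foldr ℤ._+_ ℤ.0ℤ (xs ++ ys) ≡ foldr ℤ._+_ ℤ.0ℤ xs ℤ.+ foldr ℤ._+_ ℤ.0ℤ ys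
foldr-+-++ []       ys = sym (ℤₚ.+-identityˡ _)
foldr-+-++ (x ∷ xs) ys = trans (cong (ℤ._+_ x) (foldr-+-++ xs ys)) (sym (ℤₚ.+-assoc x _ _))

∑⊆-suc : (g : Subset (suc k) → ℤ) →
         ∑⊆ (suc k) g ≡ ∑⊆ k (g ∘ (outside ∷_)) ℤ.+ ∑⊆ k (g ∘ (inside ∷_))
∑⊆-suc {k} g = begin
  ∑⊆ (suc k) g
    ≡⟨ cong (foldr ℤ._+_ ℤ.0ℤ) (List.map-++ g (map (outside ∷_) (allSubsets k)) _) ⟩
  _ ≡⟨ foldr-+-++ (map g (map (outside ∷_) (allSubsets k))) _ ⟩
  _ ≡⟨ cong₂ (λ xs ys → foldr ℤ._+_ ℤ.0ℤ xs ℤ.+ foldr ℤ._+_ ℤ.0ℤ ys)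
         (List.map-∘ (allSubsets k)) (List.map-∘ (allSubsets k)) ⟨
  ∑⊆ k (g ∘ (outside ∷_)) ℤ.+ ∑⊆ k (g ∘ (inside ∷_)) ∎

*-distribˡ-∑⊆ : ∀ c (g : Subset k → ℤ) → c * ∑⊆ k g ≡ ∑⊆ k (λ I → c * g I)
*-distribˡ-∑⊆ {k} c g = go (allSubsets k)
  where
  go : ∀ Is → c * foldr ℤ._+_ ℤ.0ℤ (map g Is) ≡ foldr ℤ._+_ ℤ.0ℤ (map (λ I → c * g I) Is)
  go []       = ℤₚ.*-zeroʳ c
  go (I ∷ Is) = trans (ℤₚ.*-distribˡ-+ c (g I) _) (cong (ℤ._+_ (c * g I)) (go Is))

sum-∑⊆-comm : (g : Fin l → Subset k → ℤ) →
              ℤ∑.sum (λ j → ∑⊆ k (g j)) ≡ ∑⊆ k (λ I → ℤ∑.sum (λ j → g j I))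
sum-∑⊆-comm {l} {k} g = go (allSubsets k)
  where
  go : ∀ Is → ℤ∑.sum (λ j → foldr ℤ._+_ ℤ.0ℤ (map (g j) Is)) ≡
              foldr ℤ._+_ ℤ.0ℤ (map (λ I → ℤ∑.sum (λ j → g j I)) Is)
  go []       = ℤ∑.sum-replicate-zero l
  go (I ∷ Is) = trans (ℤ∑.∑-distrib-+ (λ j → g j I) _) (cong (ℤ._+_ (ℤ∑.sum λ j → g j I)) (go Is))

pos-sum : (h : Fin l → ℕ) → + sum h ≡ ℤ∑.sum (+_ ∘ h)
pos-sum {zero}  h = refl
pos-sum {suc l} h = cong (ℤ._+_ (+ h zero)) (pos-sum (h ∘ suc))

-- Inclusion–exclusion

-- Membership of `suc i` in `s ∷ I` is decided by that of `i` in `I`, whatever `s` is.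
filter-∈?-suc : ∀ s (I : Subset k) is →
                filter (_∈? (s ∷ I)) (map suc is) ≡ map suc (filter (_∈? I) is)
filter-∈?-suc s I []       = refl
filter-∈?-suc s I (i ∷ is) with does (i ∈? I)
... | false = filter-∈?-suc s I is
... | true  = cong (suc i ∷_) (filter-∈?-suc s I is)

filter-tail : ∀ s (I : Subset k) →
  filter (_∈? (s ∷ I)) (List.tabulate suc) ≡ map suc (elements I)
filter-tail s I = trans (cong (filter (_∈? (s ∷ I))) (sym (List.map-tabulate id suc)))
                        (filter-∈?-suc s I (allFin _))

∏∈-outside : (I : Subset k) (b : Fin (suc k) → ℕ) → ∏∈ (outside ∷ I) b ≡ ∏∈ I (b ∘ suc)
∏∈-outside I b = cong product
  (trans (cong (map b) (filter-tail outside I)) (sym (List.map-∘ (elements I))))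

∏∈-inside : (I : Subset k) (b : Fin (suc k) → ℕ) → ∏∈ (inside ∷ I) b ≡ b zero ℕ.* ∏∈ I (b ∘ suc)
∏∈-inside I b = cong (λ is → b zero ℕ.* product is)
  (trans (cong (map b) (filter-tail inside I)) (sym (List.map-∘ (elements I))))

-- The left side is the product of the factors `1 - ⟦ p i ⟧`. Expanding the first factor by
-- induction on `k` separates the subsets without `zero` from those with it.
inclusion–exclusion : (p : Fin k → Bool) →
  + ⟦ does (all? λ i → ⟦ p i ⟧ ℕ.≟ 0) ⟧ ≡ ∑⊆ k (λ I → -1ℤ ^ ∣ I ∣ * + ∏∈ I (⟦_⟧ ∘ p))
inclusion–exclusion {zero}  p = refl
inclusion–exclusion {suc k} p = begin
  + ⟦ does (⟦ p zero ⟧ ℕ.≟ 0) ∧ does (all? λ i → ⟦ p (suc i) ⟧ ℕ.≟ 0) ⟧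
    ≡⟨ head-factor (p zero) _ ⟩
  rest ℤ.+ (-1ℤ * + ⟦ p zero ⟧) * rest
    ≡⟨ cong (λ z → z ℤ.+ (-1ℤ * + ⟦ p zero ⟧) * z) (inclusion–exclusion (p ∘ suc)) ⟩
  ∑⊆ k t ℤ.+ (-1ℤ * + ⟦ p zero ⟧) * ∑⊆ k t
    ≡⟨ cong₂ ℤ._+_ (∑⊆-cong λ I → cong (λ c → -1ℤ ^ ∣ I ∣ * + c) (sym (∏∈-outside I (⟦_⟧ ∘ p))))
        (trans (*-distribˡ-∑⊆ (-1ℤ * + ⟦ p zero ⟧) t) (∑⊆-cong inside-term)) ⟩
  ∑⊆ k (T ∘ (outside ∷_)) ℤ.+ ∑⊆ k (T ∘ (inside ∷_))
    ≡⟨ ∑⊆-suc T ⟨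
  ∑⊆ (suc k) T ∎
  where
  rest = + ⟦ does (all? λ i → ⟦ p (suc i) ⟧ ℕ.≟ 0) ⟧
  t : Subset k → ℤ
  t I = -1ℤ ^ ∣ I ∣ * + ∏∈ I (⟦_⟧ ∘ p ∘ suc)
  T : Subset (suc k) → ℤ
  T I = -1ℤ ^ ∣ I ∣ * + ∏∈ I (⟦_⟧ ∘ p)
  head-factor : ∀ b q → + ⟦ does (⟦ b ⟧ ℕ.≟ 0) ∧ q ⟧ ≡ + ⟦ q ⟧ ℤ.+ (-1ℤ * + ⟦ b ⟧) * + ⟦ q ⟧
  head-factor false false = refl
  head-factor false true  = refl
  head-factor true  false = refl
  head-factor true  true  = refl
  inside-term : ∀ I → (-1ℤ * + ⟦ p zero ⟧) * t I ≡ T (inside ∷ I)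
  inside-term I = begin
    (-1ℤ * + ⟦ p zero ⟧) * (-1ℤ ^ ∣ I ∣ * + ∏∈ I (⟦_⟧ ∘ p ∘ suc))
      -- The new sign joins the power of `-1ℤ` and the new entry joins the product.
      ≡⟨ interchange -1ℤ (+ ⟦ p zero ⟧) (-1ℤ ^ ∣ I ∣) _ ⟩
    (-1ℤ * -1ℤ ^ ∣ I ∣) * (+ ⟦ p zero ⟧ * + ∏∈ I (⟦_⟧ ∘ p ∘ suc))
      ≡⟨ cong (-1ℤ ^ suc ∣ I ∣ *_) (trans (sym (ℤₚ.pos-* ⟦ p zero ⟧ _))
           (cong +_ (sym (∏∈-inside I (⟦_⟧ ∘ p))))) ⟩
    T (inside ∷ I) ∎

theorem2 : (m n k : ℕ) → .{{_ : NonZero m}} → .{{_ : NonZero n}} → .{{_ : NonZero k}} →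
    (X : Fin k → Subset m) → (Y : Fin k → Subset n) → PairwiseDisjoint X →
    (f : Labelling m n) →
    + zeroColumns (incidence X Y (Bijection.to f)) ≡ ∑⊆ k (λ I → -1ℤ ^ ∣ I ∣ * + B X Y I)
theorem2 m n k X Y disj f = begin
  + zeroColumns (incidence X Y to)
    ≡⟨ cong +_ (∣tabulate∣ {n ℕ.^ m} _) ⟩
  + ∑[ j < n ℕ.^ m ] ⟦ does (all? λ i → incidence X Y to i j ℕ.≟ 0) ⟧
    ≡⟨ pos-sum {n ℕ.^ m} _ ⟩
  ℤ∑.sum (λ j → + ⟦ does (all? λ i → incidence X Y to i j ℕ.≟ 0) ⟧)
    -- Column by column, the indicator of a zero column is expanded over the subsets `I`.
    ≡⟨ ℤ∑.sum-cong-≗ (λ j → inclusion–exclusion λ i →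
         does (Vec.≡-dec _≟ᵇ_ (image (to j) (X i)) (Y i))) ⟩
  ℤ∑.sum (λ j → ∑⊆ k λ I → -1ℤ ^ ∣ I ∣ * + ∏∈ I (λ i → incidence X Y to i j))
    ≡⟨ sum-∑⊆-comm (λ j I → -1ℤ ^ ∣ I ∣ * + ∏∈ I (λ i → incidence X Y to i j)) ⟩
  ∑⊆ k (λ I → ℤ∑.sum λ j → -1ℤ ^ ∣ I ∣ * + ∏∈ I (λ i → incidence X Y to i j))
    ≡⟨ ∑⊆-cong (λ I → trans
         (sym (ℤ∑.*-distribˡ-sum (-1ℤ ^ ∣ I ∣) (λ j → + ∏∈ I (λ i → incidence X Y to i j))))
         (cong (-1ℤ ^ ∣ I ∣ *_) (trans (sym (pos-sum {n ℕ.^ m} _)) (cong +_ (count I))))) ⟩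
  ∑⊆ k (λ I → -1ℤ ^ ∣ I ∣ * + B X Y I) ∎
  where
  open Bijection f using (to)
  constraints : Subset k → List (Constraint m n)
  constraints I = map (λ i → X i , Y i) (elements I)
  constraints-disjoint : ∀ I → Disjoint (constraints I)
  -- The list `elements I` has no repetitions, so its indices are pairwise distinct and `disj`
  -- applies.
  constraints-disjoint I = AllPairs.map⁺ (AllPairs.map (disj _ _) (filter⁺ (_∈? I) (allFin⁺ k)))
  count : ∀ I → ∑[ j < n ℕ.^ m ] ∏∈ I (λ i → incidence X Y to i j) ≡ B X Y I
  count I = begin
    ∑[ j < n ℕ.^ m ] ∏∈ I (λ i → incidence X Y to i j)
      -- A product of matrix entries over `I` is the indicator that all constraints from `I` hold.
      ≡⟨ sum-cong-≗ {n ℕ.^ m} (λ j → cong product (List.map-∘ (elements I))) ⟩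
    ∑[ j < n ℕ.^ m ] satisfied (to j) (constraints I)
      ≡⟨ sum-labelling f (λ g → satisfied g (constraints I)) (satisfied-ext (constraints I)) ⟩
    ∑→ (λ g → satisfied g (constraints I))
      ≡⟨ ∑→-satisfied (constraints I) (constraints-disjoint I) ⟩
    n ℕ.^ uncovered (constraints I) ℕ.* weight (constraints I)
      ≡⟨ cong₂ (λ Zs ws → n ℕ.^ ∣ ∁ (⋃ Zs) ∣ ℕ.* product ws)
           (List.map-∘ (elements I)) (List.map-∘ (elements I)) ⟨
    B X Y I ∎
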